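{- Let $F\subset A^*$ be a recurrent set and let $X\subset F$ be an $F$-thin set. The following conditions are equivalent: (i) $X$ is an $F$-maximal bifix code; (ii) $X$ is a prefix code which is left $F$-complete; (ii') $X$ is a suffix code which is right $F$-complete; (iii) $X$ is both an $F$-maximal prefix code and an $F$-maximal suffix code.
   Context: $A$ is a finite alphabet, $A^*$ the free monoid, $1$ the empty word, $A^+=A^*\setminus\{1\}$. A set $F\subset A^*$ is factorial if it is nonempty and contains all factors of its elements; it is recurrent if it is factorial and for all $u,w\in F$ there is $v\in F$ with $uvw\in F$. A prefix code is a set $X\subset A^+$ in which no element is a proper prefix of another; a suffix code is defined symmetrically; a bifix code is both. For $X\subset F$: $X$ is an $F$-maximal prefix (resp. suffix, bifix) code if it is a prefix (resp. suffix, bifix) code not properly contained in any prefix (resp. suffix, bifix) code $Y\subset F$. $X$ is $F$-thin if some word of $F$ is not a factor of any word of $X$. $X$ is right $F$-complete if every word of $F$ is a prefix of a word of $X^*$, and left $F$-complete if every word of $F$ is a suffix of a word of $X^*$. -}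

module Defs where

open import Data.List.Base using (List; []; _++_; concat)
open import Data.List.Relation.Unary.All using (All)
open import Data.List.Relation.Binary.Infix.Heterogeneous using (Infix)
open import Data.List.Relation.Binary.Prefix.Heterogeneous using (Prefix)
open import Data.List.Relation.Binary.Suffix.Heterogeneous using (Suffix)
open import Data.Product.Base using (∃-syntax; _×_)
open import Level using (0ℓ)
open import Relation.Binary.PropositionalEquality.Core using (_≡_; _≢_)
open import Relation.Nullary.Negation.Core using (¬_)
open import Relation.Unary using (Pred; _∈_; _∉_; _⊆_; _⊄_; Satisfiable)

Language : Set → Set₁
Language A = Pred (List A) 0ℓ

module _ {A : Set} where

  IsPrefixOf IsSuffixOf IsFactorOf IsProperPrefixOf IsProperSuffixOf : List A → List A → Set
  IsPrefixOf = Prefix _≡_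
  IsSuffixOf = Suffix _≡_
  IsFactorOf = Infix _≡_
  IsProperPrefixOf u w = IsPrefixOf u w × u ≢ w
  IsProperSuffixOf u w = IsSuffixOf u w × u ≢ w

  Star : Language A → Language A
  Star X w = ∃[ xs ] All X xs × concat xs ≡ w

  Factorial : Language A → Set
  Factorial F = Satisfiable F × (∀ {u w} → w ∈ F → IsFactorOf u w → u ∈ F)

  Recurrent : Language A → Set
  Recurrent F = Factorial F
    × (∀ {u w} → u ∈ F → w ∈ F → ∃[ v ] v ∈ F × (u ++ v ++ w) ∈ F)

  PrefixCode : Language A → Set
  PrefixCode X = [] ∉ X
    × (∀ {x y} → x ∈ X → y ∈ X → ¬ IsProperPrefixOf x y)

  SuffixCode : Language A → Set
  SuffixCode X = [] ∉ X
    × (∀ {x y} → x ∈ X → y ∈ X → ¬ IsProperSuffixOf x y)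

  BifixCode : Language A → Set
  BifixCode X = PrefixCode X × SuffixCode X

  -- X ⊄ Y is the library's "X is not a proper subset of Y".
  Maximal : (Language A → Set) → Language A → Language A → Set₁
  Maximal Code F X = Code X × (∀ (Y : Language A) → Y ⊆ F → Code Y → X ⊄ Y)

  MaximalPrefixCode MaximalSuffixCode MaximalBifixCode : Language A → Language A → Set₁
  MaximalPrefixCode = Maximal PrefixCode
  MaximalSuffixCode = Maximal SuffixCode
  MaximalBifixCode  = Maximal BifixCode

  Thin : Language A → Language A → Set
  Thin F X = ∃[ w ] w ∈ F × (∀ {x} → x ∈ X → ¬ IsFactorOf w x)

  RightComplete : Language A → Language A → Set
  RightComplete F X = ∀ {w} → w ∈ F → ∃[ y ] y ∈ Star X × IsPrefixOf w y

  LeftComplete : Language A → Language A → Set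
  LeftComplete F X = ∀ {w} → w ∈ F → ∃[ y ] y ∈ Star X × IsSuffixOf w y

{-# OPTIONS --safe #-}

-- Let X be a left F-complete prefix code and w ∈ F a word that is a factor of
-- no word of X.  Every word of F that begins with w lies in qX* for some
-- prefix q of w.  Call a finite set K of words a cover of p ∈ F if every
-- extension of p in F lies in qX* for some q ∈ K; thus w has a cover, and no
-- cover is empty.  If X failed to be right F-complete or a suffix code, every
-- cover of p could be replaced by a smaller cover of a longer word:
--   * if u ∈ F is not a prefix of X*, choose pvu ∈ F and q ∈ K with pv ∈ qX*;
--     no extension of pvu lies in qX*, as cancellation in X* would give a word
--     of X* beginning with u;
--   * if x and y = tx are distinct words of X, choose pvy ∈ F and q, q′ ∈ K
--     with pvt ∈ qX* and pv ∈ q′X*; then q ≠ q′, since otherwise t ∈ X*, and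
--     pvy ∈ qX* ∩ q′X*, so that q is superfluous for the extensions of pvy.
-- Finally, if a bifix code X is neither left nor right F-complete, some y ∈ F
-- is prefix-incomparable and some z ∈ F is suffix-incomparable with X, and X
-- can be enlarged by a word yvz ∈ F.
module Submission where

open import Defs
open import Axiom.ExcludedMiddle using (ExcludedMiddle)
open import Data.Empty using (⊥-elim)
open import Data.Fin.Base using (Fin)
open import Data.List.Base using (List; []; _∷_; _++_; concat; inits; length; reverse)
open import Data.List.Membership.Propositional using () renaming (_∈_ to _∈ᴸ_)
open import Data.List.Membership.Propositional.Properties using (∈-map⁺)
open import Data.List.Properties using (++-assoc; ++-cancelˡ; ++-conicalˡ; ++-identityʳ; ++-identityʳ-unique; concat-++; length-++-≤ʳ; reverse-++; reverse-injective; reverse-involutive; ∷-injectiveˡ; ∷-injectiveʳ)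
open import Data.List.Relation.Binary.Infix.Heterogeneous using (_++ⁱ_; MkView; here) renaming (toView to infixView)
open import Data.List.Relation.Binary.Pointwise using (Pointwise-≡⇒≡; ≡⇒Pointwise-≡)
open import Data.List.Relation.Binary.Prefix.Heterogeneous using (_++ᵖ_) renaming (toView to prefixView; _++_ to _++ᵛ_)
open import Data.List.Relation.Binary.Prefix.Heterogeneous.Properties using (fromPointwise)
open import Data.List.Relation.Binary.Suffix.Heterogeneous using () renaming (toView to suffixView; _++_ to _++ᵛ_)
open import Data.List.Relation.Binary.Suffix.Heterogeneous.Properties using (fromPrefix; toPrefix-rev)
open import Data.List.Relation.Unary.All using (All; []; _∷_)
open import Data.List.Relation.Unary.All.Properties using () renaming (++⁺ to All-++⁺)
open import Data.List.Relation.Unary.Any using (here; there)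
open import Data.Nat.Base using (ℕ; suc; _<_; s≤s; s≤s⁻¹)
open import Data.Nat.Properties using (<-≤-trans; ≤-refl; ≤-reflexive; ≤-trans)
open import Data.Product.Base using (∃-syntax; _×_; _,_; proj₁; proj₂)
open import Data.Sum.Base using (_⊎_; inj₁; inj₂; map₂)
open import Function.Bundles using (_↔_; _⇔_; mk⇔)
open import Level using (0ℓ)
open import Relation.Binary.PropositionalEquality using (_≡_; _≢_; refl; sym; trans; cong; subst; module ≡-Reasoning)
open import Relation.Nullary using (¬_; yes; no; contradiction)
open import Relation.Nullary.Decidable using (decidable-stable)
open import Relation.Unary using (_∈_; _∉_; _⊆_; _∪_; ｛_｝)

private
  variable
    A : Set
    F G X Y : Language A
    a b c d p q r s t u v w x y : List A

-- Decompositions of words and factorial sets.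

prefix⇒++ : IsPrefixOf u w → ∃[ r ] u ++ r ≡ w
prefix⇒++ pre with eqs ++ᵛ r ← prefixView pre = r , cong (_++ r) (Pointwise-≡⇒≡ eqs)

++-prefix : (u r : List A) → IsPrefixOf u (u ++ r)
++-prefix u r = fromPointwise (≡⇒Pointwise-≡ refl) ++ᵖ r

suffix⇒++ : IsSuffixOf u w → ∃[ s ] s ++ u ≡ w
suffix⇒++ suf with s ++ᵛ eqs ← suffixView suf = s , cong (s ++_) (Pointwise-≡⇒≡ eqs)

factor⇒++ : IsFactorOf u w → ∃[ s ] ∃[ r ] s ++ u ++ r ≡ w
factor⇒++ fac with MkView s eqs r ← infixView fac =
  s , r , cong (λ z → s ++ z ++ r) (Pointwise-≡⇒≡ eqs)

++-factor : (s u r : List A) → IsFactorOf u (s ++ u ++ r)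
++-factor s u r = s ++ⁱ here (++-prefix u r)

-- Levi's lemma.
++-compare : (a c : List A) → a ++ b ≡ c ++ d →
  (∃[ e ] a ++ e ≡ c × b ≡ e ++ d) ⊎ (∃[ e ] a ≡ c ++ e × e ++ b ≡ d)
++-compare []       c        eq = inj₁ (c , refl , eq)
++-compare (x ∷ a)  []       eq = inj₂ (x ∷ a , refl , eq)
++-compare (x ∷ a)  (y ∷ c)  eq with ∷-injectiveˡ eq | ++-compare a c (∷-injectiveʳ eq)
... | refl | inj₁ (e , c≡ , b≡) = inj₁ (e , cong (x ∷_) c≡ , b≡)
... | refl | inj₂ (e , a≡ , d≡) = inj₂ (e , cong (x ∷_) a≡ , d≡)

∈-inits : (q e : List A) → q ∈ᴸ inits (q ++ e)
∈-inits []      e = here refl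
∈-inits (x ∷ q) e = there (∈-map⁺ (x ∷_) (∈-inits q e))

-- Deletes the entry that the membership proof points at, so no equality of words has to be decided.
-- Further copies of `q` may survive in `K′`.
remove : {K : List (List A)} → q ∈ᴸ K →
  ∃[ K′ ] length K ≡ suc (length K′) × (∀ {p} → p ∈ᴸ K → p ≡ q ⊎ p ∈ᴸ K′)
remove (here refl) = _ , refl , λ where
  (here p≡q)  → inj₁ p≡q
  (there p∈K) → inj₂ p∈K
remove (there q∈K) with K′ , eq , split ← remove q∈K = _ ∷ K′ , cong suc eq , λ where
  (here p≡k)  → inj₂ (here p≡k)
  (there p∈K) → map₂ there (split p∈K)

prefix-closed : Factorial F → (u r : List A) → u ++ r ∈ F → u ∈ F
prefix-closed (_ , factors) u r ur∈F = factors ur∈F (++-factor [] u r)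

suffix-closed : Factorial F → (s u : List A) → s ++ u ∈ F → u ∈ F
suffix-closed {F = F} (_ , factors) s u su∈F =
  factors (subst (λ z → s ++ z ∈ F) (sym (++-identityʳ u)) su∈F) (++-factor s u [])

-- Factorizations over a code and cancellation.

Star-[] : [] ∈ Star X
Star-[] = [] , [] , refl

Star-∷ : x ∈ X → w ∈ Star X → x ++ w ∈ Star X
Star-∷ x∈X (xs , xs⊆X , refl) = _ ∷ xs , x∈X ∷ xs⊆X , refl

Star-[_] : x ∈ X → x ∈ Star X
Star-[_] {x = x} {X = X} x∈X = subst (Star X) (++-identityʳ x) (Star-∷ x∈X Star-[])

Star-++ : v ∈ Star X → w ∈ Star X → v ++ w ∈ Star X
Star-++ (xs , xs⊆X , refl) (ys , ys⊆X , refl) =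
  xs ++ ys , All-++⁺ xs⊆X ys⊆X , sym (concat-++ xs ys)

-- Cuts a factorization right after `s`. The cut falls either between two factors, and then `q` is
-- empty, or inside a factor `x`, and then `q` is what remains of `x`.
concat-suffix : (s : List A) {xs : List (List A)} → All X xs → concat xs ≡ s ++ t →
  ∃[ q ] ∃[ c ] c ∈ Star X × q ++ c ≡ t × (q ≡ [] ⊎ (∃[ x ] x ∈ X × (∃[ s ] s ++ q ≡ x)))
concat-suffix []        {xs}     xs⊆X         eq = [] , _ , (xs , xs⊆X , eq) , refl , inj₁ refl
concat-suffix s@(_ ∷ _) {x ∷ xs} (x∈X ∷ xs⊆X) eq with ++-compare x s eq
... | inj₁ (s′ , _ , eq′)  = concat-suffix s′ xs⊆X eq′
... | inj₂ (q , x≡sq , qc) = q , concat xs , (xs , xs⊆X , refl) , qc , inj₂ (x , x∈X , s , sym x≡sq)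

prefixCode-≡ : PrefixCode X → x ∈ X → y ∈ X → x ++ a ≡ y ++ b → x ≡ y
prefixCode-≡ {x = x} {y = y} code x∈X y∈X eq with ++-compare x y eq
... | inj₁ ([] , x≡y , _) = trans (sym (++-identityʳ x)) x≡y
... | inj₂ ([] , x≡y , _) = trans x≡y (++-identityʳ y)
... | inj₁ (e@(_ ∷ _) , refl , _) =
  contradiction (++-prefix x e , λ x≡xe → contradiction (++-identityʳ-unique x x≡xe) λ ())
                (proj₂ code x∈X y∈X)
... | inj₂ (e@(_ ∷ _) , refl , _) =
  contradiction (++-prefix y e , λ y≡ye → contradiction (++-identityʳ-unique y y≡ye) λ ())
                (proj₂ code y∈X x∈X)

-- The first factors on both sides agree by `prefixCode-≡` and are stripped in turn. The left
-- factors cannot outlast the right ones, since the empty word would then be in `X`.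
concat-cancel : PrefixCode X → {xs ys : List (List A)} → All X xs → All X ys →
  concat xs ++ r ≡ concat ys → r ∈ Star X
concat-cancel code {ys = ys} [] ys⊆X eq = ys , ys⊆X , sym eq
concat-cancel {X = X} code {x ∷ xs} (x∈X ∷ _) [] eq =
  contradiction (subst X (++-conicalˡ x _ (++-conicalˡ (x ++ concat xs) _ eq)) x∈X) (proj₁ code)
concat-cancel {r = r} code {x ∷ xs} {y ∷ ys} (x∈X ∷ xs⊆X) (y∈X ∷ ys⊆X) eq =
  concat-cancel code xs⊆X ys⊆X (++-cancelˡ x _ _ (trans eq′ (cong (_++ concat ys) (sym x≡y))))
  where
  eq′ : x ++ concat xs ++ r ≡ y ++ concat ys
  eq′ = trans (sym (++-assoc x (concat xs) r)) eq

  x≡y : x ≡ y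
  x≡y = prefixCode-≡ code x∈X y∈X eq′

Star-cancel : PrefixCode X → c ∈ Star X → c ++ r ∈ Star X → r ∈ Star X
Star-cancel code (_ , xs⊆X , refl) (_ , ys⊆X , eq) = concat-cancel code xs⊆X ys⊆X (sym eq)

-- Covers and their descent.

_∙Star_ : List A → Language A → Language A
(q ∙Star X) w = ∃[ c ] c ∈ Star X × q ++ c ≡ w

∙Star-++ : w ∈ q ∙Star X → r ∈ Star X → w ++ r ∈ q ∙Star X
∙Star-++ {q = q} (c , c∈X* , refl) r∈X* = _ , Star-++ c∈X* r∈X* , sym (++-assoc q c _)

∙Star-cancel : PrefixCode X → w ∈ q ∙Star X → w ++ r ∈ q ∙Star X → r ∈ Star X
∙Star-cancel {X = X} {q = q} {r = r} code (c , c∈X* , refl) (d , d∈X* , eq) =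
  Star-cancel code c∈X* (subst (Star X) (++-cancelˡ q d (c ++ r) (trans eq (++-assoc q c r))) d∈X*)

Covers : (F X : Language A) → List A → List (List A) → Set
Covers F X p K = ∀ r → p ++ r ∈ F → ∃[ q ] q ∈ᴸ K × p ++ r ∈ q ∙Star X

covers-++ : (p s : List A) {K : List (List A)} → Covers F X p K → Covers F X (p ++ s) K
covers-++ {F = F} {X = X} p s cov r psr∈F
  with q , q∈K , psr∈qX* ← cov (s ++ r) (subst F (++-assoc p s r) psr∈F)
  = q , q∈K , subst (q ∙Star X) (sym (++-assoc p s r)) psr∈qX*

covers-self : {K : List (List A)} → Covers F X p K → p ∈ F → ∃[ q ] q ∈ᴸ K × p ∈ q ∙Star X
covers-self {F = F} {X = X} {p = p} {K = K} cov p∈F =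
  subst (λ z → ∃[ q ] q ∈ᴸ K × z ∈ q ∙Star X) (++-identityʳ p)
    (cov [] (subst F (sym (++-identityʳ p)) p∈F))

-- Some word of `Star X` ends with `w ++ r`; its factorization is cut just before `w`. The remainder
-- `q` of the cut factor cannot reach past `w`, or `w` would be a factor of a word of `X`, so `q` is
-- a prefix of `w`.
thin-covers : LeftComplete F X → (∀ {x} → x ∈ X → ¬ IsFactorOf w x) → Covers F X w (inits w)
thin-covers {w = w} complete avoids r wr∈F
  with y , (xs , xs⊆X , concat≡y) , suf ← complete wr∈F
  with s , swr≡y ← suffix⇒++ suf
  with concat-suffix s xs⊆X (trans concat≡y (sym swr≡y))
... | q , c , c∈X* , qc≡wr , inj₁ refl = [] , ∈-inits [] w , c , c∈X* , qc≡wr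
... | q , c , c∈X* , qc≡wr , inj₂ (x , x∈X , s′ , s′q≡x) with ++-compare q w qc≡wr
...   | inj₁ (e , refl , _) = q , ∈-inits q e , c , c∈X* , qc≡wr
...   | inj₂ (e , refl , _) = contradiction (subst (IsFactorOf w) s′q≡x (++-factor s′ w e)) (avoids x∈X)

-- Infinite descent on the length of the cover, with `n` as a strict bound on it.
covers-descent :
  (∀ {p K} → p ∈ F → Covers F X p K →
    ∃[ p′ ] ∃[ K′ ] p′ ∈ F × Covers F X p′ K′ × length K′ < length K) →
  {K : List (List A)} → p ∈ F → ¬ Covers F X p K
covers-descent {F = F} {X = X} shrink {K} = go (suc (length K)) ≤-refl
  where
  go : ∀ n {p K} → length K < n → p ∈ F → ¬ Covers F X p K
  go (suc n) K<n p∈F cov with _ , _ , p′∈F , cov′ , K′<K ← shrink p∈F cov =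
    go n (<-≤-trans K′<K (s≤s⁻¹ K<n)) p′∈F cov′

-- Consequences of left completeness for a prefix code.

leftComplete⇒rightComplete : ExcludedMiddle 0ℓ → Recurrent F → Thin F X →
  PrefixCode X → LeftComplete F X → RightComplete F X
leftComplete⇒rightComplete {F = F} {X = X} em (factorial , recur) (w , w∈F , avoids) code complete {u} u∈F
  -- The descent only refutes that no word of `Star X` begins with `u`; excluded middle turns this
  -- into existence.
  = decidable-stable em λ noExt →
      covers-descent (shrink noExt) w∈F (thin-covers complete avoids)
  where
  shrink : ¬ (∃[ y ] y ∈ Star X × IsPrefixOf u y) → ∀ {p K} → p ∈ F → Covers F X p K →
    ∃[ p′ ] ∃[ K′ ] p′ ∈ F × Covers F X p′ K′ × length K′ < length K
  shrink noExt {p} {K} p∈F cov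
    with v , _ , pvu∈F ← recur p∈F u∈F
    with pvu∈F ← subst F (sym (++-assoc p v u)) pvu∈F
    with q , q∈K , pv∈qX* ← cov v (prefix-closed factorial (p ++ v) u pvu∈F)
    with K′ , eq , split ← remove q∈K
    = (p ++ v) ++ u , K′ , pvu∈F , cov′ , ≤-reflexive (sym eq)
    where
    cov′ : Covers F X ((p ++ v) ++ u) K′
    cov′ r pvur∈F
      with q′ , q′∈K , pvur∈q′X* ← covers-++ {F = F} (p ++ v) u (covers-++ {F = F} p v cov) r pvur∈F
      with split q′∈K
    ... | inj₂ q′∈K′ = q′ , q′∈K′ , pvur∈q′X*
    ... | inj₁ refl  = contradiction
      (u ++ r , ∙Star-cancel code pv∈qX* (subst (q ∙Star X) (++-assoc (p ++ v) u r) pvur∈q′X*) , ++-prefix u r)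
      noExt

leftComplete⇒suffixCode : Recurrent F → X ⊆ F → Thin F X →
  PrefixCode X → LeftComplete F X → SuffixCode X
leftComplete⇒suffixCode {F = F} {X = X} (factorial , recur) X⊆F (w , w∈F , avoids) code complete
  = proj₁ code , λ {x} {y} → notProper {x} {y}
  where
  module _ {t x} (x∈X : x ∈ X) (tx∈X : t ++ x ∈ X) (x≢tx : x ≢ t ++ x) where

    -- If `t` began with a factor `z` in `X`, then `z` and `t ++ x` would be comparable words of a
    -- prefix code, hence equal, which forces `x` to be empty.
    t∉Star : t ∉ Star X
    t∉Star ([] , [] , refl) = x≢tx refl
    t∉Star (z ∷ zs , z∈X ∷ zs⊆X , refl)
      with assoc ← ++-assoc z (concat zs) x
      with z≡tx ← prefixCode-≡ {a = concat zs ++ x} {b = []} code z∈X tx∈X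
                       (trans (sym assoc) (sym (++-identityʳ _)))
      with zs++x≡[] ← ++-identityʳ-unique z (trans z≡tx assoc)
      with refl ← trans (cong (_++ x) (sym (++-conicalˡ (concat zs) x zs++x≡[]))) zs++x≡[]
      = contradiction x∈X (proj₁ code)

    shrink : ∀ {p K} → p ∈ F → Covers F X p K →
      ∃[ p′ ] ∃[ K′ ] p′ ∈ F × Covers F X p′ K′ × length K′ < length K
    shrink {p} {K} p∈F cov
      with v , _ , pvtx∈F ← recur p∈F (X⊆F tx∈X)
      with pvtx∈F ← subst F (sym (++-assoc p v (t ++ x))) pvtx∈F
      with cov₁ ← covers-++ {F = F} p v cov
      with q , q∈K , pvt∈qX* ← cov₁ t (prefix-closed factorial ((p ++ v) ++ t) x
                                        (subst F (sym (++-assoc (p ++ v) t x)) pvtx∈F))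
      with q′ , q′∈K , pv∈q′X* ← covers-self {F = F} cov₁ (prefix-closed factorial (p ++ v) (t ++ x) pvtx∈F)
      with K′ , eq , split ← remove q∈K
      with split q′∈K
    ... | inj₁ refl  = contradiction (∙Star-cancel code pv∈q′X* pvt∈qX*) t∉Star
    ... | inj₂ q′∈K′ = (p ++ v) ++ (t ++ x) , K′ , pvtx∈F , cov′ , ≤-reflexive (sym eq)
      where
      pvtx∈qX* : (p ++ v) ++ (t ++ x) ∈ q ∙Star X
      pvtx∈qX* = subst (q ∙Star X) (++-assoc (p ++ v) t x) (∙Star-++ pvt∈qX* Star-[ x∈X ])

      cov′ : Covers F X ((p ++ v) ++ (t ++ x)) K′
      cov′ r pvtxr∈F with q″ , q″∈K , pvtxr∈q″X* ← covers-++ {F = F} (p ++ v) (t ++ x) cov₁ r pvtxr∈F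
                     with split q″∈K
      ... | inj₂ q″∈K′ = q″ , q″∈K′ , pvtxr∈q″X*
      -- Cancelling `pvtx` under `q` leaves `r` in `Star X`; appending `t ++ x` and then `r` to `pv`
      -- therefore stays under `q′`, which takes over from `q`.
      ... | inj₁ refl  = q′ , q′∈K′ ,
        ∙Star-++ (∙Star-++ pv∈q′X* Star-[ tx∈X ]) (∙Star-cancel code pvtx∈qX* pvtxr∈q″X*)

  notProper : ∀ {x y} → x ∈ X → y ∈ X → ¬ IsProperSuffixOf x y
  notProper x∈X y∈X (suf , x≢y) with t , refl ← suffix⇒++ suf =
    covers-descent (shrink x∈X y∈X x≢y) w∈F (thin-covers complete avoids)

-- Completeness, maximality and enlargement of prefix codes.

-- A word `y` of a larger prefix code is a prefix of a product of words of `X`, so it is comparable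
-- with the first factor and equals it.
maximalPrefixCode : PrefixCode X → RightComplete F X → MaximalPrefixCode F X
maximalPrefixCode {X = X} code complete = code , λ Y Y⊆F codeY (X⊆Y , Y⊈X) →
  Y⊈X λ y∈Y → absorb codeY X⊆Y y∈Y (complete (Y⊆F y∈Y))
  where
  absorb : PrefixCode Y → X ⊆ Y → y ∈ Y → ∃[ z ] z ∈ Star X × IsPrefixOf y z → y ∈ X
  absorb {Y = Y} {y = y} codeY X⊆Y y∈Y (z , (xs , xs⊆X , concat≡z) , pre)
    with r , yr≡z ← prefix⇒++ pre
    with xs | xs⊆X | trans yr≡z (sym concat≡z)
  ... | []     | []       | yr≡[] =
    contradiction (subst Y (++-conicalˡ y r yr≡[]) y∈Y) (proj₁ codeY)
  ... | x ∷ _  | x∈X ∷ _  | yr≡xs =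
    subst X (sym (prefixCode-≡ codeY y∈Y (X⊆Y x∈X) yr≡xs)) x∈X

-- Having a common right extension means that one of the two words is a prefix of the other; this
-- form treats both directions at once.
Meets : Language A → List A → Set
Meets X y = ∃[ x ] x ∈ X × (∃[ a ] ∃[ b ] x ++ a ≡ y ++ b)

Meets-++⁻ : (y s : List A) → Meets X (y ++ s) → Meets X y
Meets-++⁻ y s (x , x∈X , a , b , eq) = x , x∈X , a , s ++ b , trans eq (++-assoc y s b)

-- Induction on the length of the word: a comparable `x` either already extends `w`, or is split off
-- from it. The rest is in `F` as a suffix of `w`, and is shorter because `x` is nonempty.
meets⇒rightComplete : Factorial F → [] ∉ X → (∀ {y} → y ∈ F → y ≢ [] → Meets X y) → RightComplete F X
meets⇒rightComplete {F = F} {X = X} factorial []∉X meets = go _ ≤-refl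
  where
  go : ∀ n {w} → length w < n → w ∈ F → ∃[ y ] y ∈ Star X × IsPrefixOf w y
  go _       {[]}        _   _   = [] , Star-[] , ++-prefix [] []
  go (suc n) {w@(_ ∷ _)} w<n w∈F with meets w∈F (λ ())
  ... | x , x∈X , a , b , eq with ++-compare x w eq
  ...   | inj₂ (e , refl , _) = x , Star-[ x∈X ] , ++-prefix w e
  ...   | inj₁ (e , xe≡w , _) with x
  ...     | []         = contradiction x∈X []∉X
  ...     | x′@(_ ∷ x″)
    with refl ← xe≡w
    with y , y∈X* , pre ← go n (≤-trans (s≤s (length-++-≤ʳ e {x″})) (s≤s⁻¹ w<n))
                               (suffix-closed factorial x′ e w∈F)
    with r , refl ← prefix⇒++ pre
    = x′ ++ e ++ r , Star-∷ x∈X y∈X* , subst (IsPrefixOf w) (++-assoc x′ e r) (++-prefix (x′ ++ e) r)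

rightComplete⊎unmet : ExcludedMiddle 0ℓ → Factorial F → [] ∉ X →
  RightComplete F X ⊎ (∃[ y ] y ∈ F × y ≢ [] × ¬ Meets X y)
rightComplete⊎unmet {F = F} {X = X} em factorial []∉X
  with em {∃[ y ] y ∈ F × y ≢ [] × ¬ Meets X y}
... | yes unmet = inj₂ unmet
... | no ¬unmet = inj₁ (meets⇒rightComplete factorial []∉X λ y∈F y≢[] →
  decidable-stable em λ ¬meets → ¬unmet (_ , y∈F , y≢[] , ¬meets))

prefixCode-∪ : PrefixCode X → y ≢ [] → ¬ Meets X y → PrefixCode (X ∪ ｛ y ｝)
prefixCode-∪ {X = X} {y = y} code y≢[] ¬meets = []∉ , notProper
  where
  []∉ : [] ∉ X ∪ ｛ y ｝
  []∉ (inj₁ []∈X) = proj₁ code []∈X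
  []∉ (inj₂ y≡[]) = y≢[] y≡[]

  notProper : ∀ {u v} → u ∈ X ∪ ｛ y ｝ → v ∈ X ∪ ｛ y ｝ → ¬ IsProperPrefixOf u v
  notProper (inj₁ u∈X)  (inj₁ v∈X)  = proj₂ code u∈X v∈X
  notProper (inj₂ refl) (inj₂ refl) (_ , u≢v) = u≢v refl
  notProper (inj₁ u∈X)  (inj₂ refl) (pre , _) with r , eq ← prefix⇒++ pre =
    ¬meets (_ , u∈X , r , [] , trans eq (sym (++-identityʳ _)))
  notProper (inj₂ refl) (inj₁ v∈X)  (pre , _) with r , eq ← prefix⇒++ pre =
    ¬meets (_ , v∈X , [] , r , trans (++-identityʳ _) (sym eq))

-- Left-right duality

-- Records rather than functions, so that languages can be inferred: unification
-- cannot invert reverse.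
record Rev (X : Language A) (w : List A) : Set where
  constructor reversed
  field unreversed : reverse w ∈ X

open Rev

record _⊆ʳ_ (X Y : Language A) : Set where
  constructor mirrored
  field mirror : ∀ {w} → w ∈ X → reverse w ∈ Y

open _⊆ʳ_

Rev-⊆ʳ : Rev X ⊆ʳ X
Rev-⊆ʳ = mirrored unreversed

⊆ʳ-Rev : X ⊆ʳ Rev X
⊆ʳ-Rev {X = X} = mirrored λ {w} w∈X → reversed (subst X (sym (reverse-involutive w)) w∈X)

Rev-mono : X ⊆ Y → Rev X ⊆ Rev Y
Rev-mono X⊆Y (reversed w∈X) = reversed (X⊆Y w∈X)

reverse-++-++ : (s u r : List A) → reverse (s ++ u ++ r) ≡ reverse r ++ reverse u ++ reverse s
reverse-++-++ s u r = begin
  reverse (s ++ u ++ r)                 ≡⟨ reverse-++ s (u ++ r) ⟩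
  reverse (u ++ r) ++ reverse s         ≡⟨ cong (_++ reverse s) (reverse-++ u r) ⟩
  (reverse r ++ reverse u) ++ reverse s ≡⟨ ++-assoc (reverse r) (reverse u) (reverse s) ⟩
  reverse r ++ reverse u ++ reverse s   ∎
  where open ≡-Reasoning

reverse-factor : IsFactorOf u w → IsFactorOf (reverse u) (reverse w)
reverse-factor {u = u} fac with s , r , refl ← factor⇒++ fac =
  subst (IsFactorOf (reverse u)) (sym (reverse-++-++ s u r)) (++-factor (reverse r) (reverse u) (reverse s))

reverse-∈-Star : X ⊆ʳ Y → w ∈ Star X → reverse w ∈ Star Y
reverse-∈-Star _ ([] , [] , refl) = Star-[]
reverse-∈-Star {Y = Y} X⊆ʳY (x ∷ xs , x∈X ∷ xs⊆X , refl) =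
  subst (Star Y) (sym (reverse-++ x (concat xs)))
    (Star-++ (reverse-∈-Star X⊆ʳY (xs , xs⊆X , refl)) Star-[ mirror X⊆ʳY x∈X ])

Rev-recurrent : Recurrent F → Recurrent (Rev F)
Rev-recurrent {F = F} (((f , f∈F) , factors) , recur) =
  ((reverse f , mirror ⊆ʳ-Rev f∈F) , λ { (reversed w∈F) fac → reversed (factors w∈F (reverse-factor fac)) }) ,
  Rev-recur
  where
  Rev-recur : ∀ {u w} → u ∈ Rev F → w ∈ Rev F → ∃[ v ] v ∈ Rev F × (u ++ v ++ w) ∈ Rev F
  Rev-recur {u} {w} (reversed u∈F) (reversed w∈F) with v , v∈F , wvu∈F ← recur w∈F u∈F =
    reverse v , mirror ⊆ʳ-Rev v∈F , reversed (subst F (sym eq) wvu∈F)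
    where
    eq : reverse (u ++ reverse v ++ w) ≡ reverse w ++ v ++ reverse u
    eq = trans (reverse-++-++ u (reverse v) w)
               (cong (λ z → reverse w ++ z ++ reverse u) (reverse-involutive v))

Rev-thin : Thin F X → Thin (Rev F) (Rev X)
Rev-thin (w , w∈F , avoids) = reverse w , mirror ⊆ʳ-Rev w∈F , λ { {x} (reversed x∈X) fac →
  avoids x∈X (subst (λ z → IsFactorOf z (reverse x)) (reverse-involutive w) (reverse-factor fac)) }

prefixCode⇒suffixCode : Y ⊆ʳ X → PrefixCode X → SuffixCode Y
prefixCode⇒suffixCode Y⊆ʳX ([]∉X , notProper) = (λ []∈Y → []∉X (mirror Y⊆ʳX []∈Y)) ,
  λ x∈Y y∈Y (suf , x≢y) →
    notProper (mirror Y⊆ʳX x∈Y) (mirror Y⊆ʳX y∈Y) (toPrefix-rev suf , λ eq → x≢y (reverse-injective eq))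

-- The general `Y ⊆ʳ X` serves both to pass to reversed languages, by `Rev-⊆ʳ`, and to come back, by
-- `⊆ʳ-Rev`.
suffixCode⇒prefixCode : Y ⊆ʳ X → SuffixCode X → PrefixCode Y
suffixCode⇒prefixCode Y⊆ʳX ([]∉X , notProper) = (λ []∈Y → []∉X (mirror Y⊆ʳX []∈Y)) ,
  λ x∈Y y∈Y (pre , x≢y) →
    notProper (mirror Y⊆ʳX x∈Y) (mirror Y⊆ʳX y∈Y) (fromPrefix pre , λ eq → x≢y (reverse-injective eq))

leftComplete⇒rightCompleteʳ : G ⊆ʳ F → X ⊆ʳ Y → LeftComplete F X → RightComplete G Y
leftComplete⇒rightCompleteʳ G⊆ʳF X⊆ʳY complete {w} w∈G
  with y , y∈X* , suf ← complete (mirror G⊆ʳF w∈G)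
  = reverse y , reverse-∈-Star X⊆ʳY y∈X* ,
    subst (λ z → IsPrefixOf z (reverse y)) (reverse-involutive w) (toPrefix-rev suf)

rightComplete⇒leftCompleteʳ : G ⊆ʳ F → X ⊆ʳ Y → RightComplete F X → LeftComplete G Y
rightComplete⇒leftCompleteʳ G⊆ʳF X⊆ʳY complete {w} w∈G
  with y , y∈X* , pre ← complete (mirror G⊆ʳF w∈G)
  = reverse y , reverse-∈-Star X⊆ʳY y∈X* ,
    subst (λ z → IsSuffixOf z (reverse y)) (reverse-involutive w) (fromPrefix pre)

-- A larger suffix code `Y` inside `F` would become a larger prefix code `Rev Y` inside `Rev F`.
maximalSuffixCode : SuffixCode X → LeftComplete F X → MaximalSuffixCode F X
maximalSuffixCode {X = X} {F = F} code complete = code , λ Y Y⊆F codeY (X⊆Y , Y⊈X) →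
  proj₂ maximalʳ (Rev Y) (Rev-mono Y⊆F) (suffixCode⇒prefixCode Rev-⊆ʳ codeY)
    (Rev-mono X⊆Y , λ RevY⊆RevX → Y⊈X λ {y} y∈Y →
      subst X (reverse-involutive y) (unreversed (RevY⊆RevX (mirror ⊆ʳ-Rev y∈Y))))
  where
  maximalʳ : MaximalPrefixCode (Rev F) (Rev X)
  maximalʳ = maximalPrefixCode (suffixCode⇒prefixCode Rev-⊆ʳ code)
    (leftComplete⇒rightCompleteʳ Rev-⊆ʳ ⊆ʳ-Rev complete)

-- The implications between the four conditions.

left⇒right : ExcludedMiddle 0ℓ → Recurrent F → X ⊆ F → Thin F X →
  PrefixCode X × LeftComplete F X → SuffixCode X × RightComplete F X
left⇒right em recurrent X⊆F thin (code , complete) =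
  leftComplete⇒suffixCode recurrent X⊆F thin code complete ,
  leftComplete⇒rightComplete em recurrent thin code complete

-- A bifix code in `F` properly containing `X` would in particular be such a prefix code.
maximalPrefixSuffix⇒maximalBifix : MaximalPrefixCode F X × MaximalSuffixCode F X → MaximalBifixCode F X
maximalPrefixSuffix⇒maximalBifix ((codeᵖ , maxᵖ) , (codeˢ , _)) =
  (codeᵖ , codeˢ) , λ Y Y⊆F (codeY , _) → maxᵖ Y Y⊆F codeY

-- Mirror image of `left⇒right`, which is applied to `Rev F` and `Rev X` and then reversed back.
right⇒left : ExcludedMiddle 0ℓ → Recurrent F → X ⊆ F → Thin F X →
  SuffixCode X × RightComplete F X → PrefixCode X × LeftComplete F X
right⇒left {F = F} {X = X} em recurrent X⊆F thin (code , complete) =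
  suffixCode⇒prefixCode ⊆ʳ-Rev (proj₁ dual) ,
  rightComplete⇒leftCompleteʳ ⊆ʳ-Rev Rev-⊆ʳ (proj₂ dual)
  where
  thinʳ : Thin (Rev F) (Rev X)
  thinʳ = Rev-thin {F = F} {X = X} thin

  codeʳ : PrefixCode (Rev X)
  codeʳ = suffixCode⇒prefixCode Rev-⊆ʳ code

  completeʳ : LeftComplete (Rev F) (Rev X)
  completeʳ = rightComplete⇒leftCompleteʳ Rev-⊆ʳ ⊆ʳ-Rev complete

  dual : SuffixCode (Rev X) × RightComplete (Rev F) (Rev X)
  dual = left⇒right {F = Rev F} {X = Rev X} em (Rev-recurrent recurrent) (Rev-mono X⊆F) thinʳ (codeʳ , completeʳ)

leftComplete⇒maximal : ExcludedMiddle 0ℓ → Recurrent F → X ⊆ F → Thin F X →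
  PrefixCode X × LeftComplete F X → MaximalPrefixCode F X × MaximalSuffixCode F X
leftComplete⇒maximal {F = F} {X = X} em recurrent X⊆F thin (code , complete) =
  maximalPrefixCode code (proj₂ dual) , maximalSuffixCode (proj₁ dual) complete
  where
  dual : SuffixCode X × RightComplete F X
  dual = left⇒right {F = F} {X = X} em recurrent X⊆F thin (code , complete)

maximalBifix⇒leftComplete : ExcludedMiddle 0ℓ → Recurrent F → X ⊆ F → Thin F X →
  MaximalBifixCode F X → PrefixCode X × LeftComplete F X
maximalBifix⇒leftComplete {F = F} {X = X} em recurrent X⊆F thin ((codeᵖ , codeˢ) , maximal)
  with rightComplete⊎unmet {F = F} {X = X} em (proj₁ recurrent) (proj₁ codeᵖ)
     | rightComplete⊎unmet {F = Rev F} {X = Rev X} em (proj₁ (Rev-recurrent recurrent))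
         (λ []∈ → proj₁ codeᵖ (unreversed []∈))
... | inj₁ complete | _ = right⇒left {F = F} {X = X} em recurrent X⊆F thin (codeˢ , complete)
... | inj₂ _ | inj₁ completeʳ =
  codeᵖ , rightComplete⇒leftCompleteʳ ⊆ʳ-Rev Rev-⊆ʳ completeʳ
-- The word `z` is found among the reversals, so `reverse z` is the word of `F` that is
-- suffix-incomparable with `X`. The new word `m` begins with `y` and ends with `reverse z`.
... | inj₂ (y , y∈F , y≢[] , y-unmet) | inj₂ (z , reversed z∈F , z≢[] , z-unmet)
  with v , _ , yvz∈F ← proj₂ recurrent y∈F z∈F
  = ⊥-elim (maximal (X ∪ ｛ m ｝) ∪⊆F (∪-prefix , ∪-suffix)
      -- The enlargement is proper: if `m` were in `X`, then `y` would be a prefix of a word of `X`.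
      (inj₁ , λ Y⊆X → y-unmet (Meets-++⁻ y _ (m , Y⊆X (inj₂ refl) , [] , [] , refl))))
  where
  m : List _
  m = y ++ v ++ reverse z

  ∪⊆F : X ∪ ｛ m ｝ ⊆ F
  ∪⊆F (inj₁ x∈X)  = X⊆F x∈X
  ∪⊆F (inj₂ refl) = yvz∈F

  ∪-prefix : PrefixCode (X ∪ ｛ m ｝)
  ∪-prefix = prefixCode-∪ codeᵖ (λ m≡[] → y≢[] (++-conicalˡ y _ m≡[])) λ met → y-unmet (Meets-++⁻ y _ met)

  reverse-m : reverse m ≡ z ++ reverse v ++ reverse y
  reverse-m = trans (reverse-++-++ y v (reverse z))
                    (cong (_++ reverse v ++ reverse y) (reverse-involutive z))

  ∪⊆ʳ : (X ∪ ｛ m ｝) ⊆ʳ (Rev X ∪ ｛ z ++ reverse v ++ reverse y ｝)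
  ∪⊆ʳ = mirrored λ where
    (inj₁ x∈X)  → inj₁ (mirror ⊆ʳ-Rev x∈X)
    (inj₂ refl) → inj₂ (sym reverse-m)

  ∪-suffix : SuffixCode (X ∪ ｛ m ｝)
  ∪-suffix = prefixCode⇒suffixCode ∪⊆ʳ
    (prefixCode-∪ (suffixCode⇒prefixCode Rev-⊆ʳ codeˢ)
      (λ eq → z≢[] (++-conicalˡ z _ eq)) λ met → z-unmet (Meets-++⁻ z _ met))

mainTheorem1 : ExcludedMiddle 0ℓ →
    (A : Set) (n : ℕ) → A ↔ Fin n →
    (F X : Language A) → Recurrent F → X ⊆ F → Thin F X →
    (MaximalBifixCode F X ⇔ (PrefixCode X × LeftComplete F X))
    × (MaximalBifixCode F X ⇔ (SuffixCode X × RightComplete F X))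
    × (MaximalBifixCode F X ⇔ (MaximalPrefixCode F X × MaximalSuffixCode F X))
mainTheorem1 em A n _ F X recurrent X⊆F thin =
  -- All equivalences are composed from the cycle (i), (ii), (iii), (i) and the two implications
  -- between (ii) and (ii').
  mk⇔ i⇒ii ii⇒i ,
  mk⇔ (λ i → ii⇒ii′ (i⇒ii i)) (λ ii′ → ii⇒i (ii′⇒ii ii′)) ,
  mk⇔ (λ i → ii⇒iii (i⇒ii i)) iii⇒i
  where
  i⇒ii : MaximalBifixCode F X → PrefixCode X × LeftComplete F X
  i⇒ii = maximalBifix⇒leftComplete {F = F} {X = X} em recurrent X⊆F thin

  ii⇒ii′ : PrefixCode X × LeftComplete F X → SuffixCode X × RightComplete F X
  ii⇒ii′ = left⇒right {F = F} {X = X} em recurrent X⊆F thin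

  ii′⇒ii : SuffixCode X × RightComplete F X → PrefixCode X × LeftComplete F X
  ii′⇒ii = right⇒left {F = F} {X = X} em recurrent X⊆F thin

  ii⇒iii : PrefixCode X × LeftComplete F X → MaximalPrefixCode F X × MaximalSuffixCode F X
  ii⇒iii = leftComplete⇒maximal {F = F} {X = X} em recurrent X⊆F thin

  iii⇒i : MaximalPrefixCode F X × MaximalSuffixCode F X → MaximalBifixCode F X
  iii⇒i = maximalPrefixSuffix⇒maximalBifix

  ii⇒i : PrefixCode X × LeftComplete F X → MaximalBifixCode F X
  ii⇒i ii = iii⇒i (ii⇒iii ii)
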